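{- Let $\mathcal A=(A,<)$ be a linear order whose universe is a decidable set of strings over a finite alphabet and such that, given a tuple $\bar a$ of elements of $A$ and $d\ge 0$, the distance-$d$ type $\operatorname{tp}_d(\mathcal A,\bar a)$ is computable. Then the datalog tuple problem over $\mathcal A$ is decidable.
   Context: A linear order is a structure $(A,<)$ with $<$ a strict linear order. For $a<b$, $d(a,b)$ is the maximum $d\ge0$ such that there are $c_0,\dots,c_d\in A$ with $a=c_0<c_1<\dots<c_d=b$, or $\infty$ if no maximum exists. For $\bar a=(a_1,\dots,a_k)\in A^k$ and $d\ge0$, $\operatorname{tp}_d(\mathcal A,\bar a)$ is the finite set of expressions containing: for all $i,j$ with $a_i\le a_j$ the expression $x_i\le_c x_j$ with $c=\min\{d,d(a_i,a_j)\}$ (with $d(a,a)=0$); for each $j$ the expression $-\infty\le_c x_j$ with $c\le d$ maximal such that there are $b_0<\dots<b_c\le a_j$ in $A$; for each $i$ the expression $x_i\le_c\infty$ with $c\le d$ maximal such that there are $a_i\le b_0<\dots<b_c$ in $A$. Datalog: atoms $R(x_1,\dots,x_k)$ (variables only, no equality, no constants); rules $P\bar x\leftarrow Q_1\bar y_1,\dots,Q_m\bar y_m$; a program is a finite set of rules; head symbols are IDBs, others EDBs; programs over $\mathcal A$ use only the EDB $<$. Semantics: IDBs start empty; at stage $i$ a rule (cycling through rules in a fixed order) $P\bar x\leftarrow Q_1\bar y_1,\dots,Q_m\bar y_m$ adds to $P$ all $\bar a$ for which there are tuples $\bar b_1,\dots,\bar b_m$ consistent with the variable identifications, with $\bar b_r\in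 Q_r^{\mathcal A}$ for EDBs and $\bar b_r$ in the stage-$(i-1)$ interpretation of $Q_r$ for IDBs; $P_\infty$ is the union over all stages. The datalog tuple problem over $\mathcal A$: given a datalog program $\Pi$ over $\mathcal A$, a $k$-ary IDB $P$ of $\Pi$ and $\bar a\in A^k$ ($k\ge1$), decide whether $\bar a\in P_\infty$. -}

module Defs where

open import Data.Nat using (ℕ; zero; suc; _≤_; _<_; NonZero)
open import Data.Nat.DivMod using (_mod_)
open import Data.Fin using (Fin)
open import Data.List using (List; []; _∷_; length)
import Data.List as List
open import Data.List.Relation.Unary.All using (All)
open import Data.List.Relation.Unary.Any using (Any)
open import Data.Vec using (Vec)
import Data.Vec as Vec
open import Data.Maybe using (Maybe; just; nothing)
open import Data.Bool using (Bool; T)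
open import Data.Product using (Σ; ∃; _×_; _,_)
open import Data.Sum using (_⊎_)
open import Data.Empty using (⊥)
open import Relation.Nullary using (¬_)
open import Relation.Binary.PropositionalEquality using (_≡_; _≢_)

Strings : ℕ → Set
Strings m = List (Fin m)

Universe : (m : ℕ) → (Strings m → Bool) → Set
Universe m inA = Σ (Strings m) (λ s → T (inA s))

module LinOrder {A : Set} (_≺_ : A → A → Set) where

  -- strict linear order (totality stated in its weakest, negative form)
  record IsStrictLinearOrder : Set where
    field
      irrefl    : ∀ x → ¬ (x ≺ x)
      trans     : ∀ {x y z} → x ≺ y → y ≺ z → x ≺ z
      connected : ∀ x y → x ≢ y → ¬ (¬ (x ≺ y) × ¬ (y ≺ x))

  _≼_ : A → A → Set
  x ≼ y = (x ≺ y) ⊎ (x ≡ y)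

  data Chain : A → A → ℕ → Set where
    here : ∀ {x} → Chain x x zero
    step : ∀ {x y z n} → x ≺ y → Chain y z n → Chain x z (suc n)

  -- d(x,y) ≥ n   (possibly d(x,y) = ∞)
  DistGeq : A → A → ℕ → Set
  DistGeq x y n = ∃ λ m → n ≤ m × Chain x y m

  DistEq : A → A → ℕ → Set
  DistEq x y c = Chain x y c × (∀ m → Chain x y m → m ≤ c)

  MinDist : ℕ → A → A → ℕ → Set
  MinDist d x y c = (c ≡ d × DistGeq x y d) ⊎ (c < d × DistEq x y c)

  LeftChain : A → ℕ → Set
  LeftChain x c = ∃ λ b₀ → ∃ λ b → Chain b₀ b c × b ≼ x

  RightChain : A → ℕ → Set
  RightChain x c = ∃ λ b₀ → ∃ λ b → x ≼ b₀ × Chain b₀ b c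

  IsMaxUpTo : ℕ → (ℕ → Set) → ℕ → Set
  IsMaxUpTo d Q c = c ≤ d × Q c × (∀ c' → c' ≤ d → Q c' → c' ≤ c)

-- A (syntactic) distance type of a k-tuple:
--   rel i j = just c   encodes the expression  x_i ≤_c x_j ,
--   rel i j = nothing  means there is no expression for (i , j),
--   left j  = c        encodes  -∞ ≤_c x_j ,
--   right i = c        encodes  x_i ≤_c ∞ .
record Tp (k : ℕ) : Set where
  field
    rel   : Fin k → Fin k → Maybe ℕ
    left  : Fin k → ℕ
    right : Fin k → ℕ

module TpSpec {A : Set} (_≺_ : A → A → Set) where
  open LinOrder _≺_

  RelSpec : ℕ → A → A → Maybe ℕ → Set
  RelSpec d x y nothing  = ¬ (x ≼ y)
  RelSpec d x y (just c) = x ≼ y × MinDist d x y c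

  IsTp : ∀ {k} → ℕ → Vec A k → Tp k → Set
  IsTp d a t =
      (∀ i j → RelSpec d (Vec.lookup a i) (Vec.lookup a j) (Tp.rel t i j))
    × (∀ j → IsMaxUpTo d (LeftChain (Vec.lookup a j)) (Tp.left t j))
    × (∀ i → IsMaxUpTo d (RightChain (Vec.lookup a i)) (Tp.right t i))

-- Datalog programs over linear orders (only EDB: <).
-- Variables are natural numbers; IDB symbols are Fin n with arities ar.

data Atom (n : ℕ) (ar : Fin n → ℕ) : Set where
  lessA : ℕ → ℕ → Atom n ar
  idbA  : (P : Fin n) → Vec ℕ (ar P) → Atom n ar

record Rule (n : ℕ) (ar : Fin n → ℕ) : Set where
  field
    head  : Fin n
    hargs : Vec ℕ (ar head)
    body  : List (Atom n ar)

record Program : Set where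
  field
    nIDB  : ℕ
    ar    : Fin nIDB → ℕ
    rules : List (Rule nIDB ar)

IsIDB : (Π : Program) → Fin (Program.nIDB Π) → Set
IsIDB Π P = Any (λ r → Rule.head r ≡ P) (Program.rules Π)

-- the rule applied at stage i+1 (cycling through the rules in order)
ruleAt : ∀ {R : Set} → List R → ℕ → Maybe R
ruleAt [] i = nothing
ruleAt (r ∷ rs) i = just (List.lookup (r ∷ rs) (i mod suc (length rs)))

module Semantics {A : Set} (_≺_ : A → A → Set) (Π : Program) where
  open Program Π

  Interp : Set₁
  Interp = (P : Fin nIDB) → Vec A (ar P) → Set

  SatAtom : (ℕ → A) → Interp → Atom nIDB ar → Set
  SatAtom ν I (lessA x y)  = ν x ≺ ν y
  SatAtom ν I (idbA P xs) = I P (Vec.map ν xs)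

  Fires : Rule nIDB ar → Interp → Interp
  Fires r I P t = Σ (Rule.head r ≡ P) λ { _≡_.refl →
      ∃ λ (ν : ℕ → A) → Vec.map ν (Rule.hargs r) ≡ t × All (SatAtom ν I) (Rule.body r) }

  FiresM : Maybe (Rule nIDB ar) → Interp → Interp
  FiresM nothing  I P t = ⊥
  FiresM (just r) I P t = Fires r I P t

  stage : ℕ → Interp
  stage zero    P t = ⊥
  stage (suc i) P t = stage i P t ⊎ FiresM (ruleAt rules i) (stage i) P t

  Infty : Interp
  Infty P t = ∃ λ i → stage i P t

{-# OPTIONS --safe #-}

-- Add endpoints −∞ and ∞ to A. Conjunctions of conditions "there is a chain of length c from x to
-- some point below y" are closed under existential quantification in every linear order: finitely
-- many lower and upper bounds on z can be met simultaneously as soon as they can be met in pairs,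
-- and a pair x + a ≤ z ≤ y − b can be met iff a chain of length a + b leads from x to y. So all stages
-- are finite unions of sets defined by matrices of natural numbers, where larger entries define
-- smaller sets. By Dickson's lemma only finitely many matrices are added before every new one is
-- dominated by an old one, and membership in the resulting set is read off from distance types.
module Submission where

open import Defs
open import Data.Nat using (ℕ; zero; suc; _≤_; _<_; _+_; _*_; _∸_; _⊔_; z≤n; s≤s; s≤s⁻¹; _≤?_;
                             _≤′_; ≤′-refl; ≤′-step)
  renaming (_≟_ to _≟ℕ_)
open import Data.Nat.Properties
  using (≤-refl; ≤-trans; ≤-antisym; ≰⇒>; <⇒≱; ≤⇒≤′; n≤1+n; m≤m+n; m≤n+m; m≤m*n; m≤m⊔n; m≤n⊔m; ⊔-sel;
         +-comm; m+[n∸m]≡n; m+n∸m≡n; anyUpTo?)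
open import Data.Nat.DivMod using (_mod_; m<n⇒m%n≡m; [m+kn]%n≡m%n; m%n<n)
open import Data.Nat.Induction using (<-rec)
open import Data.Fin using (Fin; zero; suc; _↑ʳ_; _↑ˡ_; _≟_; toℕ; splitAt)
open import Data.Fin.Properties using (splitAt-↑ˡ; splitAt-↑ʳ; toℕ-fromℕ<; toℕ-injective; toℕ<n; all?)
open import Data.Bool using (Bool)
open import Data.List as List using (List; []; _∷_; _++_; cartesianProductWith; allFin; concatMap; length)
open import Data.List.Relation.Unary.Any as Any using (Any; here; there)
import Data.List.Relation.Unary.Any.Properties as Anyₚ
open import Data.List.Relation.Unary.All as All using (All; []; _∷_)
import Data.List.Relation.Unary.All.Properties as Allₚ
open import Data.List.Membership.Propositional using (_∈_; find; lose)
open import Data.List.Membership.Propositional.Properties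
  using (∈-map⁺; ∈-map⁻; ∈-concatMap⁺; ∈-concatMap⁻; ∈-cartesianProductWith⁺; ∈-cartesianProductWith⁻;
         ∈-allFin; ∈-lookup; ∈-++⁺ˡ; ∈-++⁺ʳ; ∈-tabulate⁺)
open import Data.Maybe using (just; nothing)
open import Data.Vec as Vec using (Vec; []; _∷_; lookup)
open import Data.Vec.Properties using (lookup-map; tabulate∘lookup; tabulate-cong)
open import Data.Product using (Σ; ∃; ∃₂; _×_; _,_; proj₁; proj₂)
open import Data.Sum as Sum using (_⊎_; inj₁; inj₂; [_,_]′)
open import Data.Unit using (⊤; tt)
open import Data.Empty using (⊥-elim)
open import Function using (_∘_; _on_; flip)
open import Relation.Nullary using (¬_; Dec; yes; no; contradiction; _×-dec_)
open import Relation.Nullary.Decidable using (map′)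
open import Relation.Nullary.Construct.Add.Extrema using (_±; ⊥±; ⊤±; [_]; [_]-injective)
open import Relation.Binary
  using (IsStrictTotalOrder; Trans; Transitive; Total; Reflexive; Trichotomous; tri<; tri≈; tri>;
         isStrictTotalOrderᶜ)
open import Relation.Binary.PropositionalEquality as ≡ using (_≡_; refl; sym; trans; cong; cong₂; subst; subst₂)
import Relation.Binary.Construct.StrictToNonStrict as NonStrict
import Relation.Binary.Construct.Add.Extrema.Strict as Extrema

-- Dickson's lemma

-- Almost-full relations and their closure under intersection follow Vytiniotis, Coquand and Wahlstedt,
-- "Stop when you are almost-full"; af-meet₀ and af-meet₁ are the cases of nullary and unary P and Q.
data AlmostFull {X : Set} (R : X → X → Set) : Set where
  now   : (∀ x y → R x y) → AlmostFull R
  later : (∀ x → AlmostFull (λ y z → R y z ⊎ R x y)) → AlmostFull R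

module _ {X : Set} where

  af-mono : {R S : X → X → Set} → (∀ {x y} → R x y → S x y) → AlmostFull R → AlmostFull S
  af-mono f (now r)   = now λ x y → f (r x y)
  af-mono f (later r) = later λ x → af-mono (Sum.map f f) (r x)

  af-on : {Y : Set} {R : X → X → Set} (f : Y → X) → AlmostFull R → AlmostFull (R on f)
  af-on f (now r)   = now λ x y → r (f x) (f y)
  af-on f (later r) = later λ x → af-on f (r (f x))

  private
    meet : {P Q C : Set} → C ⊎ P → C ⊎ Q → C ⊎ (P × Q)
    meet (inj₁ c) _        = inj₁ c
    meet (inj₂ p) (inj₁ c) = inj₁ c
    meet (inj₂ p) (inj₂ q) = inj₂ (p , q)

  af-meet₀ : {R S : X → X → Set} (C : X → X → Set) (P Q : Set) →
             (∀ {x y} → R x y → C x y ⊎ P) → (∀ {x y} → S x y → C x y ⊎ Q) →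
             AlmostFull R → AlmostFull S → AlmostFull (λ x y → C x y ⊎ (P × Q))
  af-meet₀ C P Q f g (now r)   s = af-mono (λ q → meet (f (r _ _)) (g q)) s
  af-meet₀ C P Q f g (later r) s = later λ x → af-mono
    (λ { (inj₁ (inj₁ c)) → inj₁ (inj₁ c)
       ; (inj₁ (inj₂ c)) → inj₂ (inj₁ c)
       ; (inj₂ pq)       → inj₁ (inj₂ pq) })
    (af-meet₀ (λ y z → C y z ⊎ C x y) P Q
      [ [ inj₁ ∘ inj₁ , inj₂ ]′ ∘ f , [ inj₁ ∘ inj₂ , inj₂ ]′ ∘ f ]′
      ([ inj₁ ∘ inj₁ , inj₂ ]′ ∘ g)
      (r x) s)

  af-meet₁ : {R S : X → X → Set} (C : X → X → Set) (P Q : X → Set) →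
             (∀ {x y} → R x y → C x y ⊎ P x) → (∀ {x y} → S x y → C x y ⊎ Q x) →
             AlmostFull R → AlmostFull S → AlmostFull (λ x y → C x y ⊎ (P x × Q x))
  af-meet₁ C P Q f g (now r)       s       = af-mono (λ q → meet (f (r _ _)) (g q)) s
  af-meet₁ C P Q f g r@(later _) (now s)   = af-mono (λ p → meet (f p) (g (s _ _))) r
  af-meet₁ {R} {S} C P Q f g r@(later r′) s@(later s′) = later λ x →
    let C′ : X → X → Set
        C′ y z = C y z ⊎ C x y
        D : X → X → Set
        D y z = C′ y z ⊎ (P y × Q y)
    in af-mono
      (λ { (inj₁ (inj₁ (inj₁ c))) → inj₁ (inj₁ c)
         ; (inj₁ (inj₁ (inj₂ c))) → inj₂ (inj₁ c)
         ; (inj₁ (inj₂ pq))       → inj₁ (inj₂ pq)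
         ; (inj₂ pq)              → inj₂ (inj₂ pq) })
      -- With `x` fixed, `P x` and `Q x` no longer depend on the pair compared. Each inner call
      -- shrinks one derivation and carries its own proposition as an extra disjunct; `af-meet₀`
      -- joins the two into `P x × Q x`.
      (af-meet₀ D (P x) (Q x)
        (λ { (inj₁ (inj₁ c)) → inj₁ (inj₁ c)
           ; (inj₁ (inj₂ p)) → inj₂ p
           ; (inj₂ pq)       → inj₁ (inj₂ pq) })
        (λ { (inj₁ (inj₁ c)) → inj₁ (inj₁ c)
           ; (inj₁ (inj₂ q)) → inj₂ q
           ; (inj₂ pq)       → inj₁ (inj₂ pq) })
        (af-meet₁ (λ y z → C′ y z ⊎ P x) P Q
          [ [ inj₁ ∘ inj₁ ∘ inj₁ , inj₂ ]′ ∘ f , [ inj₁ ∘ inj₁ ∘ inj₂ , inj₁ ∘ inj₂ ]′ ∘ f ]′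
          ([ inj₁ ∘ inj₁ ∘ inj₁ , inj₂ ]′ ∘ g)
          (r′ x) s)
        (af-meet₁ (λ y z → C′ y z ⊎ Q x) P Q
          ([ inj₁ ∘ inj₁ ∘ inj₁ , inj₂ ]′ ∘ f)
          [ [ inj₁ ∘ inj₁ ∘ inj₁ , inj₂ ]′ ∘ g , [ inj₁ ∘ inj₁ ∘ inj₂ , inj₁ ∘ inj₂ ]′ ∘ g ]′
          r (s′ x)))

  af-∩ : {R S : X → X → Set} → AlmostFull R → AlmostFull S → AlmostFull (λ x y → R x y × S x y)
  af-∩ (now r)       s       = af-mono (λ q → r _ _ , q) s
  af-∩ r@(later _) (now s)   = af-mono (λ p → p , s _ _) r
  af-∩ {R} {S} r@(later r′) s@(later s′) = later λ x → af-meet₁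
    (λ y z → R y z × S y z) (R x) (S x)
    (λ { (inj₁ p , q) → inj₁ (p , q) ; (inj₂ p , q) → inj₂ p })
    (λ { (p , inj₁ q) → inj₁ (p , q) ; (p , inj₂ q) → inj₂ q })
    (af-∩ (r′ x) s) (af-∩ r (s′ x))

  af-Π : ∀ k {R : Fin k → X → X → Set} → (∀ i → AlmostFull (R i)) →
         AlmostFull (λ x y → ∀ i → R i x y)
  af-Π zero    r = now λ _ _ ()
  af-Π (suc k) r = af-mono (λ { (p , q) zero → p ; (p , q) (suc i) → q i })
    (af-∩ (r zero) (af-Π k (r ∘ suc)))

-- Well-founded induction on the first number `n` drawn: a second number `m` either satisfies
-- `n ≤ m`, or is smaller than `n` and takes over its role.
af-≤ : AlmostFull _≤_
af-≤ = later (<-rec _ λ n rec → later (above n rec))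
  where
  above : ∀ n → (∀ {m} → m < n → AlmostFull (λ y z → y ≤ z ⊎ m ≤ y)) → ∀ m →
          AlmostFull (λ y z → (y ≤ z ⊎ n ≤ y) ⊎ (m ≤ y ⊎ n ≤ m))
  above n rec m with n ≤? m
  ... | yes n≤m = now λ _ _ → inj₂ (inj₂ n≤m)
  ... | no  n≰m = af-mono (Sum.map inj₁ inj₁) (rec (≰⇒> n≰m))

-- Accessibility of `xs` under adding elements to which no listed element is `R`-related. The loop
-- `saturate` recurses on it.
data Noetherian {X : Set} (R : X → X → Set) (xs : List X) : Set where
  noeth : (∀ y → ¬ Any (λ x → R x y) xs → Noetherian R (y ∷ xs)) → Noetherian R xs

-- Invariant: `S` exceeds `R` only where its first argument is already dominated by `xs`. Listing an
-- undominated `y` preserves this, since the new disjunct `S y a` makes `a` dominated by `y`.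
af⇒noetherian : {X : Set} {R S : X → X → Set} {xs : List X} → AlmostFull S →
                (∀ {y z} → S y z → R y z ⊎ Any (λ x → R x y) xs) → Noetherian R xs
af⇒noetherian (now s) f = noeth λ y ¬y → noeth λ z ¬z →
  ⊥-elim ([ ¬z ∘ here , ¬y ]′ (f (s y z)))
af⇒noetherian {R = R} {S} {xs} (later s) f = noeth λ y ¬y →
  let extend : ∀ {a b} → S a b ⊎ S y a → R a b ⊎ Any (λ x → R x a) (y ∷ xs)
      extend = λ { (inj₁ p) → Sum.map₂ there (f p)
                 ; (inj₂ p) → [ inj₂ ∘ here , (λ q → ⊥-elim (¬y q)) ]′ (f p) }
  in af⇒noetherian (s y) extend

-- Distance constraints in linear orders

least : ∀ {n} {B : Set} {_≲_ : B → B → Set} → Transitive _≲_ → Reflexive _≲_ → Total _≲_ →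
        (f : Fin (suc n) → B) → ∃ λ i → ∀ j → f i ≲ f j
least {zero}  tr rf tot f = zero , λ { zero → rf }
least {suc n} tr rf tot f with least tr rf tot (f ∘ suc)
... | i , p with tot (f zero) (f (suc i))
...   | inj₁ q = zero , λ { zero → rf ; (suc j) → tr q (p j) }
...   | inj₂ q = suc i , λ { zero → q ; (suc j) → p j }

-- A system of distance constraints: the entry 0 imposes nothing, and suc c asks for a chain of length c
-- (see Within below). Thus x ≤ y is the entry 1 and x < y the entry 2.
Matrix : ℕ → Set
Matrix n = Fin n → Fin n → ℕ

infixl 7 _⊙_
-- Composition of constraints through a middle node. Lengths add up, and a trivial factor leaves
-- nothing to compose.
_⊙_ : ℕ → ℕ → ℕ
zero  ⊙ _     = 0
suc a ⊙ zero  = 0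
suc a ⊙ suc b = suc (a + b)

-- A diagonal entry above 1 is unsatisfiable; loop c is then put into every entry of the projection.
loop : ℕ → ℕ
loop (suc (suc c)) = suc (suc c)
loop _             = 0

-- Fourier-Motzkin elimination of node `zero`: `⊔` conjoins the direct constraint with the one
-- routed through `zero`.
eliminate : ∀ {n} → Matrix (suc n) → Matrix n
eliminate M i j = M (suc i) (suc j) ⊔ (M (suc i) zero ⊙ M zero (suc j) ⊔ loop (M zero zero))

project : ∀ k {n} → Matrix (k + n) → Matrix n
project zero    M = M
project (suc k) M = project k (eliminate M)

module Distance {B : Set} {_<_ : B → B → Set} (isSTO : IsStrictTotalOrder _≡_ _<_) where
  open IsStrictTotalOrder isSTO using (compare; irrefl; isEquivalence; <-resp-≈) renaming (trans to <-trans)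
  open NonStrict _≡_ _<_ using () renaming (_≤_ to _≲_)

  ≲-trans : Transitive _≲_
  ≲-trans = NonStrict.trans _≡_ _<_ isEquivalence <-resp-≈ <-trans

  ≲-total : Total _≲_
  ≲-total = NonStrict.total _≡_ _<_ compare

  ≲-<-trans : Trans _≲_ _<_ _<_
  ≲-<-trans = NonStrict.≤-<-trans _≡_ _<_ sym <-trans (proj₂ <-resp-≈)

  <-≲-trans : Trans _<_ _≲_ _<_
  <-≲-trans = NonStrict.<-≤-trans _≡_ _<_ <-trans (proj₁ <-resp-≈)

  infix 4 _≲[_]_
  -- The weak step after the strict ones makes the relation antitone in the length and monotone in
  -- both endpoints.
  data _≲[_]_ : B → ℕ → B → Set where
    near : ∀ {x y} → x ≲ y → x ≲[ 0 ] y
    step : ∀ {x y z c} → x < y → y ≲[ c ] z → x ≲[ suc c ] z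

  ≲[]-monoˡ : ∀ {x y z c} → x ≲ y → y ≲[ c ] z → x ≲[ c ] z
  ≲[]-monoˡ p (near q)   = near (≲-trans p q)
  ≲[]-monoˡ p (step q r) = step (≲-<-trans p q) r

  ≲[]-monoʳ : ∀ {x y z c} → y ≲ z → x ≲[ c ] y → x ≲[ c ] z
  ≲[]-monoʳ p (near q)   = near (≲-trans q p)
  ≲[]-monoʳ p (step q r) = step q (≲[]-monoʳ p r)

  ≲[]-trans : ∀ {x y z a b} → x ≲[ a ] y → y ≲[ b ] z → x ≲[ a + b ] z
  ≲[]-trans (near p)   r = ≲[]-monoˡ p r
  ≲[]-trans (step p q) r = step p (≲[]-trans q r)

  ≲[]-split : ∀ a {b x z} → x ≲[ a + b ] z → ∃ λ y → x ≲[ a ] y × y ≲[ b ] z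
  ≲[]-split zero    p = _ , near (inj₂ refl) , p
  ≲[]-split (suc a) (step p q) with ≲[]-split a q
  ... | y , r , s = y , step p r , s

  ≲[]⇒≲ : ∀ {x y c} → x ≲[ c ] y → x ≲ y
  ≲[]⇒≲ (near p)   = p
  ≲[]⇒≲ (step p q) = ≲-trans (inj₁ p) (≲[]⇒≲ q)

  ≲[]-irrefl : ∀ {x c} → ¬ (x ≲[ suc c ] x)
  ≲[]-irrefl {x} (step p q) with ≲[]⇒≲ q
  ... | inj₁ r    = irrefl refl (<-trans p r)
  ... | inj₂ refl = irrefl refl p

  ≲[]-antitone : ∀ {x y a b} → a ≤ b → x ≲[ b ] y → x ≲[ a ] y
  ≲[]-antitone z≤n     p          = near (≲[]⇒≲ p)
  ≲[]-antitone (s≤s h) (step p q) = step p (≲[]-antitone h q)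

  -- No length is lost at a prescribed point: a strict step that crosses `y` is replaced by a strict
  -- step starting in `y`.
  ≲[]-splitAt : ∀ {x y z c} → x ≲ y → y ≲ z → x ≲[ c ] z →
                ∃₂ λ a b → a + b ≡ c × x ≲[ a ] y × y ≲[ b ] z
  ≲[]-splitAt p q (near _) = 0 , 0 , refl , near p , near q
  ≲[]-splitAt {y = y} p q (step {y = w} r s) with compare y w
  ... | tri< y<w _ _  = 0 , _ , refl , near p , step y<w s
  ... | tri≈ _ refl _ = 1 , _ , refl , step r (near (inj₂ refl)) , s
  ... | tri> _ _ w<y with ≲[]-splitAt (inj₁ w<y) q s
  ...   | a , b , refl , t , u = suc a , b , refl , step r t , u

  Within : ℕ → B → B → Set
  Within zero    x y = ⊤
  Within (suc c) x y = x ≲[ c ] y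

  within-antitone : ∀ {m n x y} → m ≤ n → Within n x y → Within m x y
  within-antitone z≤n     p = tt
  within-antitone (s≤s h) p = ≲[]-antitone h p

  within-⊔⁺ : ∀ {x y} m n → Within m x y → Within n x y → Within (m ⊔ n) x y
  within-⊔⁺ m n p q with m ⊔ n | ⊔-sel m n
  ... | _ | inj₁ refl = p
  ... | _ | inj₂ refl = q

  within-⊔⁻ : ∀ {x y} m n → Within (m ⊔ n) x y → Within m x y × Within n x y
  within-⊔⁻ m n p = within-antitone (m≤m⊔n m n) p , within-antitone (m≤n⊔m m n) p

  within-monoˡ : ∀ m {x y z} → x ≲ y → Within m y z → Within m x z
  within-monoˡ zero    p q = tt
  within-monoˡ (suc m) p q = ≲[]-monoˡ p q

  within-monoʳ : ∀ m {x y z} → y ≲ z → Within m x y → Within m x z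
  within-monoʳ zero    p q = tt
  within-monoʳ (suc m) p q = ≲[]-monoʳ p q

  within-⊙ : ∀ m n {x y z} → Within m x y → Within n y z → Within (m ⊙ n) x z
  within-⊙ zero    n       p q = tt
  within-⊙ (suc m) zero    p q = tt
  within-⊙ (suc m) (suc n) p q = ≲[]-trans p q

  within-⊙⁻ : ∀ {m n x z} → 1 ≤ m → 1 ≤ n → Within (m ⊙ n) x z →
              ∃ λ y → Within m x y × Within n y z
  within-⊙⁻ {suc m} {suc n} _ _ p = ≲[]-split m p

  loop⁺ : ∀ m {x u v} → Within m x x → Within (loop m) u v
  loop⁺ zero          p = tt
  loop⁺ (suc zero)    p = tt
  loop⁺ (suc (suc m)) p = ⊥-elim (≲[]-irrefl p)

  loop⁻ : ∀ m {x u} → Within (loop m) u u → Within m x x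
  loop⁻ zero          p = tt
  loop⁻ (suc zero)    p = near (inj₂ refl)
  loop⁻ (suc (suc m)) p = ⊥-elim (≲[]-irrefl p)

  infix 4 _⊨_
  _⊨_ : ∀ {n} → (Fin n → B) → Matrix n → Set
  e ⊨ M = ∀ i j → Within (M i j) (e i) (e j)

  ⊨-resp-≗ : ∀ {n} {e e′ : Fin n → B} {M : Matrix n} → (∀ i → e i ≡ e′ i) → e ⊨ M → e′ ⊨ M
  ⊨-resp-≗ {M = M} eq p i j rewrite sym (eq i) | sym (eq j) = p i j

  ⊨-eliminate : ∀ {n} {e : Fin (suc n) → B} {M : Matrix (suc n)} → e ⊨ M → e ∘ suc ⊨ eliminate M
  ⊨-eliminate {M = M} p i j = within-⊔⁺ (M (suc i) (suc j)) _ (p _ _)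
    (within-⊔⁺ (M (suc i) zero ⊙ M zero (suc j)) _
      (within-⊙ (M (suc i) zero) _ (p _ _) (p _ _)) (loop⁺ (M zero zero) (p _ _)))

  ⊨-project : ∀ k {n} {e : Fin (k + n) → B} {M : Matrix (k + n)} → e ⊨ M → e ∘ (k ↑ʳ_) ⊨ project k M
  ⊨-project zero    p = p
  ⊨-project (suc k) {M = M} p = ⊨-project k (⊨-eliminate {M = M} p)

  -- Each up-set U i meets each down-set V j; the intersection of finitely many up-sets (down-sets)
  -- of a linear order is one of them.
  helly : ∀ {n} {U V : Fin (suc n) → B → Set} →
          (∀ i {x y} → x ≲ y → U i x → U i y) → (∀ j {x y} → x ≲ y → V j y → V j x) →
          (∀ i j → ∃ λ z → U i z × V j z) → ∃ λ z → (∀ i → U i z) × (∀ j → V j z)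
  helly {n} up down meet =
    -- The common point is the maximum over `i` of the minimum over `j` of the witnesses for `U i`
    -- and `V j`.
    let low : ∀ i → ∃ λ j → ∀ k → proj₁ (meet i j) ≲ proj₁ (meet i k)
        low i = least ≲-trans (inj₂ refl) ≲-total (proj₁ ∘ meet i)
        w : Fin (suc n) → B
        w i = proj₁ (meet i (proj₁ (low i)))
        i₀ , top = least {_≲_ = flip _≲_} (flip ≲-trans) (inj₂ refl) (flip ≲-total) w
    in w i₀ , (λ i → up i (top i) (proj₁ (proj₂ (meet i _))))
            , (λ j → down j (proj₂ (low i₀) j) (proj₂ (proj₂ (meet i₀ j))))

  cons : ∀ {n} → B → (Fin n → B) → Fin (suc n) → B
  cons z e zero    = z
  cons z e (suc i) = e i

  -- Pairs (i , j) in which i is no lower bound or j no upper bound are reduced to pairs of genuine bounds.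
  eliminate-⊨ : ∀ {n} {e : Fin n → B} {M : Matrix (suc n)} (lo hi : Fin n) →
                1 ≤ M (suc lo) zero → 1 ≤ M zero (suc hi) →
                e ⊨ eliminate M → ∃ λ z → cons z e ⊨ M
  eliminate-⊨ {suc n} {e} {M} lo hi 1≤lo 1≤hi p = z , λ
    -- Every entry of `eliminate M` contains `loop (M zero zero)`, so any diagonal entry recovers
    -- the constraint of `z` with itself; `lo` supplies a node.
    { zero    zero    → loop⁻ (M zero zero) (proj₂ (proj₂ (parts lo lo)))
    ; zero    (suc j) → proj₂ (proj₂ common) j
    ; (suc i) zero    → proj₁ (proj₂ common) i
    ; (suc i) (suc j) → proj₁ (parts i j) }
    where
    parts : ∀ i j → Within (M (suc i) (suc j)) (e i) (e j) ×
                    Within (M (suc i) zero ⊙ M zero (suc j)) (e i) (e j) ×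
                    Within (loop (M zero zero)) (e i) (e j)
    parts i j = let a , b = within-⊔⁻ (M (suc i) (suc j)) _ (p i j) in
                a , within-⊔⁻ (M (suc i) zero ⊙ M zero (suc j)) _ b

    below : ∀ i → ∃ λ i′ → 1 ≤ M (suc i′) zero ×
            (∀ {z} → Within (M (suc i′) zero) (e i′) z → Within (M (suc i) zero) (e i) z)
    below i with M (suc i) zero in eq
    ... | zero  = lo , 1≤lo , λ _ → tt
    ... | suc c = i , subst (1 ≤_) (sym eq) (s≤s z≤n) , λ {z} → subst (λ m → Within m (e i) z) eq

    above : ∀ j → ∃ λ j′ → 1 ≤ M zero (suc j′) ×
            (∀ {z} → Within (M zero (suc j′)) z (e j′) → Within (M zero (suc j)) z (e j))
    above j with M zero (suc j) in eq
    ... | zero  = hi , 1≤hi , λ _ → tt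
    ... | suc c = j , subst (1 ≤_) (sym eq) (s≤s z≤n) , λ {z} → subst (λ m → Within m z (e j)) eq

    meet : ∀ i j → ∃ λ z → Within (M (suc i) zero) (e i) z × Within (M zero (suc j)) z (e j)
    meet i j = let i′ , 1≤i′ , f = below i
                   j′ , 1≤j′ , g = above j
                   z , u , v = within-⊙⁻ 1≤i′ 1≤j′ (proj₁ (proj₂ (parts i′ j′)))
               in z , f u , g v

    common : ∃ λ z → (∀ i → Within (M (suc i) zero) (e i) z) ×
                     (∀ j → Within (M zero (suc j)) z (e j))
    common = helly {U = λ i z → Within (M (suc i) zero) (e i) z}
                   {V = λ j z → Within (M zero (suc j)) z (e j)}
                   (λ i → within-monoʳ (M (suc i) zero)) (λ j → within-monoˡ (M zero (suc j))) meet

    z : B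
    z = proj₁ common

-- Finite lists of constraints

Constraint : ℕ → Set
Constraint n = Fin n × Fin n × ℕ

entry : ∀ {n} → Constraint n → Matrix n
entry (u , v , c) i j with u ≟ i | v ≟ j
... | yes _ | yes _ = c
... | _     | _     = 0

entry-diagonal : ∀ {n} (u v : Fin n) c → entry (u , v , c) u v ≡ c
entry-diagonal u v c with u ≟ u | v ≟ v
... | yes _  | yes _  = refl
... | yes _  | no v≢v = contradiction refl v≢v
... | no u≢u | _      = contradiction refl u≢u

matrix : ∀ {n} → List (Constraint n) → Matrix n
matrix []       i j = 0
matrix (c ∷ cs) i j = entry c i j ⊔ matrix cs i j

matrix-lower : ∀ {n u v c} {cs : List (Constraint n)} → (u , v , c) ∈ cs → c ≤ matrix cs u v
matrix-lower {u = u} {v} {c} {d ∷ cs} (here refl) =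
  subst (_≤ matrix (d ∷ cs) u v) (entry-diagonal u v c) (m≤m⊔n (entry d u v) _)
matrix-lower {u = u} {v} {cs = c ∷ _} (there p) = ≤-trans (matrix-lower p) (m≤n⊔m (entry c u v) _)

-- A list instead of a matrix, because `f` need not be injective: repeated variables send several
-- entries to one pair, where `matrix` conjoins them.
pull : ∀ {k n} → (Fin k → Fin n) → Matrix k → List (Constraint n)
pull f M = cartesianProductWith (λ i j → f i , f j , M i j) (allFin _) (allFin _)

module System {B : Set} {_<_ : B → B → Set} (isSTO : IsStrictTotalOrder _≡_ _<_) where
  open Distance isSTO

  Holds : ∀ {n} → (Fin n → B) → Constraint n → Set
  Holds e (u , v , c) = Within c (e u) (e v)

  ⊨-matrix⁻ : ∀ {n} {e : Fin n → B} cs → e ⊨ matrix cs → All (Holds e) cs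
  ⊨-matrix⁻ cs p = All.tabulate λ c∈cs → within-antitone (matrix-lower c∈cs) (p _ _)

  entry⁺ : ∀ {n} {e : Fin n → B} c → Holds e c → e ⊨ entry c
  entry⁺ (u , v , c) h i j with u ≟ i | v ≟ j
  ... | yes refl | yes refl = h
  ... | yes _    | no _     = tt
  ... | no _     | _        = tt

  ⊨-matrix⁺ : ∀ {n} {e : Fin n → B} cs → All (Holds e) cs → e ⊨ matrix cs
  ⊨-matrix⁺ []       []       i j = tt
  ⊨-matrix⁺ (c ∷ cs) (h ∷ hs) i j = within-⊔⁺ (entry c i j) _ (entry⁺ c h i j) (⊨-matrix⁺ cs hs i j)

  pull⁺ : ∀ {k n} {e : Fin n → B} (f : Fin k → Fin n) {M : Matrix k} → e ∘ f ⊨ M → All (Holds e) (pull f M)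
  pull⁺ {e = e} f {M} p = All.tabulate λ c∈ → holds (∈-cartesianProductWith⁻ _ (allFin _) (allFin _) c∈)
    where
    holds : ∀ {c} → (∃₂ λ i j → i ∈ allFin _ × j ∈ allFin _ × c ≡ (f i , f j , M i j)) → Holds e c
    holds (i , j , _ , _ , refl) = p i j

  pull⁻ : ∀ {k n} {e : Fin n → B} (f : Fin k → Fin n) {M : Matrix k} → All (Holds e) (pull f M) → e ∘ f ⊨ M
  pull⁻ f h i j = All.lookup h (∈-cartesianProductWith⁺ _ (∈-allFin i) (∈-allFin j))

  -- The eliminated nodes must be bounded below by lo and above by hi, since B may have no suitable point
  -- below (above) every upper (lower) bound.
  project-⊨ : ∀ k {n} {e : Fin n → B} {M : Matrix (k + n)} (lo hi : Fin n) →
              (∀ v → 1 ≤ M (k ↑ʳ lo) (v ↑ˡ n)) → (∀ v → 1 ≤ M (v ↑ˡ n) (k ↑ʳ hi)) →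
              e ⊨ project k M → ∃ λ e′ → (∀ i → e′ (k ↑ʳ i) ≡ e i) × e′ ⊨ M
  project-⊨ zero    {e = e} lo hi above below p = e , (λ _ → refl) , p
  project-⊨ (suc k) {M = M} lo hi above below p =
    -- Node `zero` is eliminated first and so gets its value last. Elimination only enlarges
    -- entries, hence the bounds by `lo` and `hi` survive it.
    let e′ , e′≗e , q = project-⊨ k lo hi (λ v → ≤-trans (above (suc v)) (m≤m⊔n _ _))
                                          (λ v → ≤-trans (below (suc v)) (m≤m⊔n _ _)) p
        z , r = eliminate-⊨ {M = M} (k ↑ʳ lo) (k ↑ʳ hi) (above zero) (below zero) q
    in cons z e′ , e′≗e , r

vec-ext : ∀ {A : Set} {n} {xs ys : Vec A n} → (∀ i → lookup xs i ≡ lookup ys i) → xs ≡ ys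
vec-ext {xs = xs} {ys} p = trans (sym (tabulate∘lookup xs)) (trans (tabulate-cong p) (tabulate∘lookup ys))

maxVar : ∀ {k} → Vec ℕ k → ℕ
maxVar = Vec.foldr′ _⊔_ 0

map-agree : ∀ {A : Set} {k} {ν μ : ℕ → A} (xs : Vec ℕ k) → (∀ x → x ≤ maxVar xs → ν x ≡ μ x) →
            Vec.map ν xs ≡ Vec.map μ xs
map-agree []       p = refl
map-agree (x ∷ xs) p = cong₂ _∷_ (p x (m≤m⊔n x _)) (map-agree xs (λ y h → p y (≤-trans h (m≤n⊔m x _))))

-- Stages of a program

module _ {n : ℕ} {ar : Fin n → ℕ} where

  maxVarAtom : Atom n ar → ℕ
  maxVarAtom (lessA x y) = x ⊔ y
  maxVarAtom (idbA P xs) = maxVar xs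

  maxVarBody : List (Atom n ar) → ℕ
  maxVarBody = List.foldr (λ a → maxVarAtom a ⊔_) 0

  maxVarRule : Rule n ar → ℕ
  maxVarRule r = maxVar (Rule.hargs r) ⊔ maxVarBody (Rule.body r)

ruleAt⁻ : ∀ {R : Set} (rs : List R) i {r} → ruleAt rs i ≡ just r → r ∈ rs
ruleAt⁻ (r ∷ rs) i refl = ∈-lookup {xs = r ∷ rs} (i mod suc (length rs))

-- The rule of index `k` recurs at all stages congruent to `k` modulo the number `n` of rules;
-- `k + i * n` is such a stage and is at least `i`.
ruleAt⁺ : ∀ {R : Set} {rs : List R} {r} i → r ∈ rs → ∃ λ j → i ≤ j × ruleAt rs j ≡ just r
ruleAt⁺ {rs = s ∷ rs} {r} i r∈ =
  j , ≤-trans (m≤m*n i n) (m≤n+m (i * n) (toℕ k)) ,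
  cong just (trans (cong (List.lookup (s ∷ rs)) j≡k) (sym (Anyₚ.lookup-index r∈)))
  where
  n = suc (length rs)
  k : Fin n
  k = Any.index r∈
  j = toℕ k + i * n
  j≡k : j mod n ≡ k
  j≡k = toℕ-injective (trans (toℕ-fromℕ< (m%n<n j n))
          (trans ([m+kn]%n≡m%n (toℕ k) i n) (m<n⇒m%n≡m (toℕ<n k))))

module SemanticsProperties {A : Set} (_≺_ : A → A → Set) (Π : Program) where
  open Program Π
  open Semantics _≺_ Π

  sat-mono : ∀ {ν} {I J : Interp} → (∀ {P t} → I P t → J P t) → ∀ a → SatAtom ν I a → SatAtom ν J a
  sat-mono f (lessA x y) p = p
  sat-mono f (idbA P xs) p = f p

  sat-body-mono : ∀ {ν} {I J : Interp} → (∀ {P t} → I P t → J P t) →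
                  ∀ {as} → All (SatAtom ν I) as → All (SatAtom ν J) as
  sat-body-mono {I = I} {J} f = All.map λ {a} → sat-mono {I = I} {J} f a

  fires-mono : ∀ {I J : Interp} → (∀ {P t} → I P t → J P t) →
               ∀ {r P t} → Fires r I P t → Fires r J P t
  fires-mono {I} {J} f (refl , ν , eq , p) = refl , ν , eq , sat-body-mono {I = I} {J} f p

  sat-agree : ∀ {I : Interp} {ν μ : ℕ → A} a → (∀ x → x ≤ maxVarAtom a → ν x ≡ μ x) →
              SatAtom ν I a → SatAtom μ I a
  sat-agree (lessA x y)     p = subst₂ _≺_ (p x (m≤m⊔n x y)) (p y (m≤n⊔m x y))
  sat-agree {I} (idbA P xs) p = subst (I P) (map-agree xs p)

  sat-body-agree : ∀ {I : Interp} {ν μ : ℕ → A} as → (∀ x → x ≤ maxVarBody as → ν x ≡ μ x) →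
                   All (SatAtom ν I) as → All (SatAtom μ I) as
  sat-body-agree []       p []       = []
  sat-body-agree (a ∷ as) p (h ∷ hs) =
    sat-agree a (λ x x≤ → p x (≤-trans x≤ (m≤m⊔n (maxVarAtom a) _))) h ∷
    sat-body-agree as (λ x x≤ → p x (≤-trans x≤ (m≤n⊔m (maxVarAtom a) _))) hs

  stage-mono : ∀ {i j P t} → i ≤ j → stage i P t → stage j P t
  stage-mono {i} {j} i≤j = go (≤⇒≤′ i≤j)
    where
    go : ∀ {j P t} → i ≤′ j → stage i P t → stage j P t
    go ≤′-refl     p = p
    go (≤′-step h) p = inj₁ (go h p)

  common-stage : ∀ {ν} as → All (SatAtom ν Infty) as → ∃ λ i → All (SatAtom ν (stage i)) as
  common-stage []                []             = 0 , []
  common-stage (lessA x y ∷ as)  (p ∷ ps)       = let i , qs = common-stage as ps in i , p ∷ qs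
  common-stage (idbA P xs ∷ as)  ((j , p) ∷ ps) = let i , qs = common-stage as ps in
    i ⊔ j , stage-mono (m≤n⊔m i j) p ∷
    sat-body-mono {I = stage i} {stage (i ⊔ j)} (stage-mono (m≤m⊔n i j)) qs

  -- The finitely many body atoms hold at a common stage, and `r` is applied again later. With
  -- `infty-least` this characterises `Infty` as the least interpretation closed under the rules.
  infty-closed : ∀ {r P t} → r ∈ rules → Fires r Infty P t → Infty P t
  infty-closed {r} r∈ (refl , ν , eq , ps) =
    let i , qs = common-stage (Rule.body r) ps
        j , i≤j , at≡ = ruleAt⁺ i r∈
    in suc j , inj₂ (subst (λ m → FiresM m (stage j) _ _) (sym at≡)
                 (refl , ν , eq , sat-body-mono {I = stage i} {stage j} (stage-mono i≤j) qs))

  infty-least : ∀ {I : Interp} → (∀ {r P t} → r ∈ rules → Fires r I P t → I P t) →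
                ∀ {P t} → Infty P t → I P t
  infty-least {I} closed (i , p) = go i p
    where
    go : ∀ i {P t} → stage i P t → I P t
    go (suc i) (inj₁ p) = go i p
    go (suc i) (inj₂ p) with ruleAt rules i in eq
    ... | just r = closed (ruleAt⁻ rules i eq) (fires-mono (go i) p)

-- Saturation of a program

module Saturation {A : Set} {_≺_ : A → A → Set} (isSTO : IsStrictTotalOrder _≡_ _≺_) (Π : Program) where
  open Program Π
  open Extrema _≺_ using (_<±_; ⊥±<[_]; [_]<⊤±; [<]-injective; <±-isStrictTotalOrder-≡)
    renaming ([_] to [_]<)
  open Distance (<±-isStrictTotalOrder-≡ isSTO)
  open System (<±-isStrictTotalOrder-≡ isSTO)
  open Semantics _≺_ Π
  open SemanticsProperties _≺_ Π
  open NonStrict _≡_ _<±_ using () renaming (antisym to ≲-antisym)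
  module ± = IsStrictTotalOrder (<±-isStrictTotalOrder-≡ isSTO)

  env : ∀ {k} → Vec A k → Fin (2 + k) → A ±
  env t zero          = ⊥±
  env t (suc zero)    = ⊤±
  env t (suc (suc l)) = [ lookup t l ]

  -- Stands for the set of tuples `t` with `env t ⊨ M`; the two additional nodes are the extrema.
  Fact : Set
  Fact = Σ (Fin nIDB) λ P → Matrix (2 + ar P)

  matricesOf : ∀ P → List Fact → List (Matrix (2 + ar P))
  matricesOf P [] = []
  matricesOf P ((Q , M) ∷ L) with Q ≟ P
  ... | yes refl = M ∷ matricesOf P L
  ... | no _     = matricesOf P L

  Model : List Fact → Interp
  Model L P t = Any (env t ⊨_) (matricesOf P L)

  -- The smaller fact defines the larger set, so a fact above a listed one is redundant.
  data _⊑_ : Fact → Fact → Set where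
    weaker : ∀ {P M N} → (∀ i j → M i j ≤ N i j) → (P , M) ⊑ (P , N)

  _⊑?_ : ∀ F G → Dec (F ⊑ G)
  (P , M) ⊑? (Q , N) with P ≟ Q
  ... | no P≢Q   = no λ { (weaker _) → P≢Q refl }
  ... | yes refl = map′ weaker (λ { (weaker h) → h }) (all? λ i → all? λ j → M i j ≤? N i j)

  -- The successor lets positive weights detect the predicate symbol.
  weight : ∀ P → Fin (2 + ar P) → Fin (2 + ar P) → Fact → ℕ
  weight P i j (Q , M) with Q ≟ P
  ... | yes refl = suc (M i j)
  ... | no _     = 0

  weight-self : ∀ {P} M i j → weight P i j (P , M) ≡ suc (M i j)
  weight-self {P} M i j with P ≟ P
  ... | yes refl = refl
  ... | no P≢P   = contradiction refl P≢P

  weight-other : ∀ {P Q N i j} → ¬ Q ≡ P → weight P i j (Q , N) ≡ 0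
  weight-other {P} {Q} Q≢P with Q ≟ P
  ... | yes Q≡P = contradiction Q≡P Q≢P
  ... | no _    = refl

  weights⇒⊑ : ∀ {F G} → (∀ P i j → weight P i j F ≤ weight P i j G) → F ⊑ G
  weights⇒⊑ {P , M} {Q , N} h with Q ≟ P
  ... | yes refl = weaker λ i j →
    s≤s⁻¹ (subst₂ _≤_ (weight-self M i j) (weight-self N i j) (h P i j))
  ... | no Q≢P with () ← subst₂ _≤_ (weight-self M zero zero) (weight-other Q≢P) (h P zero zero)

  -- Dickson's lemma for facts: by `weights⇒⊑` it is enough to compare finitely many numbers.
  ⊑-noetherian : Noetherian _⊑_ []
  ⊑-noetherian = af⇒noetherian
    (af-Π nIDB λ P → af-Π (2 + ar P) λ i → af-Π (2 + ar P) λ j → af-on (weight P i j) af-≤)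
    (inj₁ ∘ weights⇒⊑)

  model-weaken : ∀ {L P M t} → Any (_⊑ (P , M)) L → env t ⊨ M → Model L P t
  model-weaken {(Q , N) ∷ L} {P} d p with Q ≟ P
  model-weaken {(Q , N) ∷ L} (here (weaker h)) p | yes refl = here λ i j → within-antitone (h i j) (p i j)
  model-weaken {(Q , N) ∷ L} (there d)         p | yes refl = there (model-weaken d p)
  model-weaken {(Q , N) ∷ L} (here (weaker h)) p | no Q≢P   = contradiction refl Q≢P
  model-weaken {(Q , N) ∷ L} (there d)         p | no Q≢P   = model-weaken d p

  -- Rule bodies as disjunctions of constraint systems

  module Encoding {n : ℕ} (bot top : Fin n) (var : ℕ → Fin n) where

    place : ∀ {k} → Vec ℕ k → Fin (2 + k) → Fin n
    place xs zero          = bot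
    place xs (suc zero)    = top
    place xs (suc (suc l)) = var (lookup xs l)

    atomAlternatives : List Fact → Atom nIDB ar → List (List (Constraint n))
    atomAlternatives L (lessA x y) = ((var x , var y , 2) ∷ []) ∷ []
    atomAlternatives L (idbA P xs) = List.map (pull (place xs)) (matricesOf P L)

    -- Disjunctive normal form: an alternative chooses one listed matrix for each IDB atom of the
    -- body.
    bodyAlternatives : List Fact → List (Atom nIDB ar) → List (List (Constraint n))
    bodyAlternatives L []       = [] ∷ []
    bodyAlternatives L (a ∷ as) = cartesianProductWith _++_ (atomAlternatives L a) (bodyAlternatives L as)

    module _ {e : Fin n → A ±} {ν : ℕ → A} (e-bot : e bot ≡ ⊥±) (e-top : e top ≡ ⊤±)
             (e-var : ∀ x → e (var x) ≡ [ ν x ]) where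

      e∘place : ∀ {k} (xs : Vec ℕ k) i → e (place xs i) ≡ env (Vec.map ν xs) i
      e∘place xs zero          = e-bot
      e∘place xs (suc zero)    = e-top
      e∘place xs (suc (suc l)) = trans (e-var _) (cong [_] (sym (lookup-map l ν xs)))

      atom⁻ : ∀ {L} a → Any (All (Holds e)) (atomAlternatives L a) → SatAtom ν (Model L) a
      atom⁻ (lessA x y) (here (step p (near q) ∷ [])) =
        [<]-injective (subst₂ _<±_ (e-var x) (e-var y) (<-≲-trans p q))
      atom⁻ (idbA P xs) p =
        Any.map (λ {M} h → ⊨-resp-≗ {M = M} (e∘place xs) (pull⁻ (place xs) h)) (Anyₚ.map⁻ p)

      atom⁺ : ∀ {L} a → SatAtom ν (Model L) a → Any (All (Holds e)) (atomAlternatives L a)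
      atom⁺ (lessA x y) p =
        here (step (subst₂ _<±_ (sym (e-var x)) (sym (e-var y)) [ p ]<) (near (inj₂ refl)) ∷ [])
      atom⁺ (idbA P xs) p =
        Anyₚ.map⁺ (Any.map (λ {M} h → pull⁺ (place xs) (⊨-resp-≗ {M = M} (sym ∘ e∘place xs) h)) p)

      body⁻ : ∀ {L} as → Any (All (Holds e)) (bodyAlternatives L as) → All (SatAtom ν (Model L)) as
      body⁻ []       p = []
      body⁻ (a ∷ as) p =
        let q , qs = Anyₚ.cartesianProductWith⁻ _++_ (Allₚ.++⁻ _)
                       (atomAlternatives _ a) (bodyAlternatives _ as) p
        in atom⁻ a q ∷ body⁻ as qs

      body⁺ : ∀ {L} as → All (SatAtom ν (Model L)) as → Any (All (Holds e)) (bodyAlternatives L as)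
      body⁺ []       []       = here []
      body⁺ (a ∷ as) (p ∷ ps) = Anyₚ.cartesianProductWith⁺ _++_ Allₚ.++⁺ (atom⁺ a p) (body⁺ as ps)

  -- Symbolic application of a rule

  module RuleSystem (r : Rule nIDB ar) where
    open Rule r

    V k : ℕ
    V = suc (maxVarRule r)
    k = 2 + ar head

    bot top : Fin k
    bot = zero
    top = suc zero

    arg : Fin (ar head) → Fin k
    arg l = suc (suc l)

    -- V exceeds every variable of r, so reduction modulo V leaves those variables unchanged.
    var : ℕ → Fin (V + k)
    var x = (x mod V) ↑ˡ k

    open Encoding (V ↑ʳ bot) (V ↑ʳ top) var

    above below : Fin V → Constraint (V + k)
    above v = V ↑ʳ bot , v ↑ˡ k , 2
    below v = v ↑ˡ k , V ↑ʳ top , 2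

    head≲ ≲head : Fin (ar head) → Constraint (V + k)
    head≲ l = V ↑ʳ arg l , var (lookup hargs l) , 1
    ≲head l = var (lookup hargs l) , V ↑ʳ arg l , 1

    -- The variables range over A, not over A ±, and the head tuple is the image of the head variables.
    constraints : List (Constraint (V + k)) → List (Constraint (V + k))
    constraints cs = List.tabulate above ++ List.tabulate below ++
                     List.tabulate head≲ ++ List.tabulate ≲head ++ cs

    constraints⁻ : ∀ {P : Constraint (V + k) → Set} {cs} → All P (constraints cs) →
                   (∀ v → P (above v)) × (∀ v → P (below v)) ×
                   (∀ l → P (head≲ l)) × (∀ l → P (≲head l)) × All P cs
    constraints⁻ p =
      let p₁ , q₁ = Allₚ.++⁻ (List.tabulate above) p
          p₂ , q₂ = Allₚ.++⁻ (List.tabulate below) q₁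
          p₃ , q₃ = Allₚ.++⁻ (List.tabulate head≲) q₂
          p₄ , q₄ = Allₚ.++⁻ (List.tabulate ≲head) q₃
      in Allₚ.tabulate⁻ p₁ , Allₚ.tabulate⁻ p₂ , Allₚ.tabulate⁻ p₃ , Allₚ.tabulate⁻ p₄ , q₄

    constraints⁺ : ∀ {P : Constraint (V + k) → Set} {cs} →
                   (∀ v → P (above v)) → (∀ v → P (below v)) →
                   (∀ l → P (head≲ l)) → (∀ l → P (≲head l)) → All P cs → All P (constraints cs)
    constraints⁺ p₁ p₂ p₃ p₄ q = Allₚ.++⁺ (Allₚ.tabulate⁺ p₁) (Allₚ.++⁺ (Allₚ.tabulate⁺ p₂)
      (Allₚ.++⁺ (Allₚ.tabulate⁺ p₃) (Allₚ.++⁺ (Allₚ.tabulate⁺ p₄) q)))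

    above∈ : ∀ cs v → above v ∈ constraints cs
    above∈ cs v = ∈-++⁺ˡ (∈-tabulate⁺ {f = above} v)

    below∈ : ∀ cs v → below v ∈ constraints cs
    below∈ cs v = ∈-++⁺ʳ (List.tabulate above) (∈-++⁺ˡ (∈-tabulate⁺ {f = below} v))

    system : List (Constraint (V + k)) → Matrix (V + k)
    system cs = matrix (constraints cs)

    alternatives : List Fact → List (List (Constraint (V + k)))
    alternatives L = bodyAlternatives L body

    derive : List (Constraint (V + k)) → Fact
    derive cs = head , project V (system cs)

    interior : ∀ {b} → ⊥± ≲[ 1 ] b → b ≲[ 1 ] ⊤± → ∃ λ a → b ≡ [ a ]
    interior {⊥±}    p _ = ⊥-elim (≲[]-irrefl p)
    interior {[ a ]} _ _ = a , refl
    interior {⊤±}    _ p = ⊥-elim (≲[]-irrefl p)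

    -- A solution of the projection extends to the variables of the rule. Then `above` and `below`
    -- force their values into `A`, and antisymmetry turns `head≲` and `≲head` into equality with
    -- the head tuple.
    derive-sound : ∀ {L cs t} → cs ∈ alternatives L → env t ⊨ project V (system cs) →
                   Fires r (Model L) head t
    derive-sound {L} {cs} {t} cs∈ p =
      refl , ν , vec-ext head≡ , body⁻ e-bot e-top (λ x → e-ν (x mod V)) body (lose cs∈ cs-holds)
      where
      lifted : ∃ λ e → (∀ i → e (V ↑ʳ i) ≡ env t i) × e ⊨ system cs
      -- The entries from `above` and `below` make the two extrema the bounds that `project-⊨`
      -- demands.
      lifted = project-⊨ V {M = system cs} bot top
        (λ v → ≤-trans (s≤s z≤n) (matrix-lower (above∈ cs v)))
        (λ v → ≤-trans (s≤s z≤n) (matrix-lower (below∈ cs v))) p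
      e : Fin (V + k) → A ±
      e = proj₁ lifted
      e-bot : e (V ↑ʳ bot) ≡ ⊥±
      e-bot = proj₁ (proj₂ lifted) bot
      e-top : e (V ↑ʳ top) ≡ ⊤±
      e-top = proj₁ (proj₂ lifted) top
      holds : (∀ v → Holds e (above v)) × (∀ v → Holds e (below v)) ×
              (∀ l → Holds e (head≲ l)) × (∀ l → Holds e (≲head l)) × All (Holds e) cs
      holds = constraints⁻ (⊨-matrix⁻ (constraints cs) (proj₂ (proj₂ lifted)))
      above-holds = proj₁ holds
      below-holds = proj₁ (proj₂ holds)
      head≲-holds = proj₁ (proj₂ (proj₂ holds))
      ≲head-holds = proj₁ (proj₂ (proj₂ (proj₂ holds)))
      cs-holds    = proj₂ (proj₂ (proj₂ (proj₂ holds)))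
      inside : ∀ (v : Fin V) → ∃ λ a → e (v ↑ˡ k) ≡ [ a ]
      inside v = interior (subst (_≲[ 1 ] e (v ↑ˡ k)) e-bot (above-holds v))
                          (subst (e (v ↑ˡ k) ≲[ 1 ]_) e-top (below-holds v))
      -- A valuation is defined on all of `ℕ`; it is continued periodically, in accordance with
      -- `var`.
      ν : ℕ → A
      ν x = proj₁ (inside (x mod V))
      e-ν : ∀ (v : Fin V) → e (v ↑ˡ k) ≡ [ proj₁ (inside v) ]
      e-ν v = proj₂ (inside v)
      head≡ : ∀ l → lookup (Vec.map ν hargs) l ≡ lookup t l
      head≡ l = trans (lookup-map l ν hargs) ([_]-injective (trans (sym (e-ν (lookup hargs l mod V))) (trans
        (≲-antisym ±.isEquivalence ±.trans ±.irrefl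
          (≲[]⇒≲ (≲head-holds l)) (≲[]⇒≲ (head≲-holds l)))
        (proj₁ (proj₂ lifted) (arg l)))))

    derive-complete : ∀ {L t} → Fires r (Model L) head t →
                      ∃ λ cs → cs ∈ alternatives L × env t ⊨ project V (system cs)
    derive-complete {L} {t} (refl , ν , eq , ps) = cs , cs∈ ,
      ⊨-resp-≗ {M = project V (system cs)} e-env (⊨-project V {e = e} {M = system cs}
        (⊨-matrix⁺ (constraints cs) (constraints⁺ above-holds below-holds
          (near ∘ inj₂ ∘ e-head) (near ∘ inj₂ ∘ sym ∘ e-head) cs-holds)))
      where
      e : Fin (V + k) → A ±
      e i = [ [_] ∘ ν ∘ toℕ , env t ]′ (splitAt V i)
      e-env : ∀ i → e (V ↑ʳ i) ≡ env t i
      e-env i = cong [ [_] ∘ ν ∘ toℕ , env t ]′ (splitAt-↑ʳ V k i)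
      e-inside : ∀ (v : Fin V) → e (v ↑ˡ k) ≡ [ ν (toℕ v) ]
      e-inside v = cong [ [_] ∘ ν ∘ toℕ , env t ]′ (splitAt-↑ˡ V v k)
      -- `e` records `ν` only below `V`. Its periodic continuation `μ` fits `var` and agrees with
      -- `ν` on the variables of the rule.
      μ : ℕ → A
      μ x = ν (toℕ (x mod V))
      agree : ∀ x → x ≤ maxVarRule r → ν x ≡ μ x
      agree x x≤ = cong ν (sym (trans (toℕ-fromℕ< (m%n<n x V)) (m<n⇒m%n≡m (s≤s x≤))))
      above-holds : ∀ v → e (V ↑ʳ bot) ≲[ 1 ] e (v ↑ˡ k)
      above-holds v = subst₂ _≲[ 1 ]_ (sym (e-env bot)) (sym (e-inside v)) (step ⊥±<[ _ ] (near (inj₂ refl)))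
      below-holds : ∀ v → e (v ↑ˡ k) ≲[ 1 ] e (V ↑ʳ top)
      below-holds v = subst₂ _≲[ 1 ]_ (sym (e-inside v)) (sym (e-env top)) (step [ _ ]<⊤± (near (inj₂ refl)))
      e-head : ∀ l → e (V ↑ʳ arg l) ≡ e (var (lookup hargs l))
      e-head l = trans (e-env (arg l)) (trans
        (cong [_] (trans (cong (λ s → lookup s l) (trans (sym eq)
          (map-agree hargs (λ x x≤ → agree x (≤-trans x≤ (m≤m⊔n (maxVar hargs) _))))))
          (lookup-map l μ hargs)))
        (sym (e-inside (lookup hargs l mod V))))
      alternative : ∃ λ cs → cs ∈ alternatives L × All (Holds e) cs
      alternative = find (body⁺ (e-env bot) (e-env top) (λ x → e-inside (x mod V)) body
        (sat-body-agree {I = Model L} body (λ x x≤ → agree x (≤-trans x≤ (m≤n⊔m (maxVar hargs) _))) ps))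
      cs = proj₁ alternative
      cs∈ = proj₁ (proj₂ alternative)
      cs-holds = proj₂ (proj₂ alternative)

  -- Iteration up to a closed list of facts

  candidates : List Fact → List Fact
  candidates L = concatMap (λ r → let open RuleSystem r in List.map derive (alternatives L)) rules

  -- `Closed` compares matrices rather than the sets they define and is therefore decidable;
  -- `model-weaken` carries it over to the sets.
  Closed Sound : List Fact → Set
  Closed L = All (λ F → Any (_⊑ F) L) (candidates L)
  Sound L  = ∀ {P t} → Model L P t → Infty P t

  closed⇒model : ∀ {L} → Closed L → ∀ {r P t} → r ∈ rules → Fires r (Model L) P t → Model L P t
  closed⇒model closed {r} r∈ f@(refl , _) =
    let open RuleSystem r
        cs , cs∈ , p = derive-complete f
    in model-weaken (All.lookup closed (∈-concatMap⁺ _ (lose r∈ (∈-map⁺ derive cs∈)))) p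

  candidate-sound : ∀ {L P M t} → Sound L → (P , M) ∈ candidates L → env t ⊨ M → Infty P t
  candidate-sound {L} {t = t} sound F∈ p with find (∈-concatMap⁻ _ F∈)
  ... | r , r∈ , F∈r with ∈-map⁻ (RuleSystem.derive r) F∈r
  ...   | cs , cs∈ , refl =
    infty-closed r∈ (fires-mono {I = Model L} {Infty} sound (RuleSystem.derive-sound r cs∈ p))

  sound-∷ : ∀ {F L} → Sound L → F ∈ candidates L → Sound (F ∷ L)
  sound-∷ {Q , N} sound F∈ {P} p with Q ≟ P
  sound-∷ {Q , N} sound F∈ (here h)  | yes refl = candidate-sound sound F∈ h
  sound-∷ {Q , N} sound F∈ (there p) | yes refl = sound p
  sound-∷ {Q , N} sound F∈ p         | no _     = sound p

  -- If `Closed` fails, some candidate is dominated by no listed fact, which is exactly what `noeth`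
  -- allows to be added.
  saturate : ∀ {L} → Noetherian _⊑_ L → Sound L → ∃ λ L′ → Sound L′ × Closed L′
  saturate {L} (noeth extend) sound with All.all? (λ F → Any.any? (_⊑? F) L) (candidates L)
  ... | yes closed = L , sound , closed
  ... | no ¬closed =
    let F , F∈ , new = find (Allₚ.¬All⇒Any¬ (λ F → Any.any? (_⊑? F) L) (candidates L) ¬closed)
    in saturate (extend F new) (sound-∷ sound F∈)

  infty? : (∀ c x y → Dec (x ≲[ c ] y)) → ∀ P t → Dec (Infty P t)
  infty? ≲? P t =
    -- The empty list has an empty model and is trivially sound. The model of the saturated list is
    -- `Infty`, and membership in it is a finite check of distances.
    let L , sound , closed = saturate ⊑-noetherian λ ()
    in map′ sound (infty-least {I = Model L} (closed⇒model closed))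
            (Any.any? (λ M → all? λ i → all? λ j → within? (M i j) (env t i) (env t j)) (matricesOf P L))
    where
    within? : ∀ c x y → Dec (Within c x y)
    within? zero    x y = yes tt
    within? (suc c) x y = ≲? c x y

-- Deciding distances from distance types

module _ {A : Set} (_≺_ : A → A → Set) where
  open LinOrder _≺_
  open TpSpec _≺_

  -- A maximum truncated at `d` reaches `d` exactly when `Q d` holds.
  maxUpTo? : ∀ {d Q c} → IsMaxUpTo d Q c → Dec (Q d)
  maxUpTo? {d} {c = c} (c≤d , q , greatest) with c ≟ℕ d
  ... | yes refl = yes q
  ... | no c≢d   = no λ q′ → c≢d (≤-antisym c≤d (greatest d ≤-refl q′))

  relSpec⇒≼? : ∀ {d x y r} → RelSpec d x y r → Dec (x ≼ y)
  relSpec⇒≼? {r = nothing} ¬p      = no ¬p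
  relSpec⇒≼? {r = just _}  (p , _) = yes p

  chain⇒≼ : (∀ {x y z} → x ≺ y → y ≺ z → x ≺ z) → ∀ {x y n} → Chain x y n → x ≼ y
  chain⇒≼ ≺-trans here       = inj₂ refl
  chain⇒≼ ≺-trans (step p c) with chain⇒≼ ≺-trans c
  ... | inj₁ q    = inj₁ (≺-trans p q)
  ... | inj₂ refl = inj₁ p

  relSpec⇒distGeq? : (∀ {x y z} → x ≺ y → y ≺ z → x ≺ z) →
                     ∀ {d x y r} → RelSpec d x y r → Dec (DistGeq x y d)
  relSpec⇒distGeq? ≺-trans {r = nothing} ¬p = no λ { (_ , _ , c) → ¬p (chain⇒≼ ≺-trans c) }
  relSpec⇒distGeq? ≺-trans {r = just c} (_ , inj₁ (_ , p)) = yes p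
  relSpec⇒distGeq? ≺-trans {r = just c} (_ , inj₂ (c<d , _ , longest)) =
    no λ { (m , d≤m , ch) → <⇒≱ c<d (≤-trans d≤m (longest m ch)) }

  isStrictTotalOrder : IsStrictLinearOrder → (∀ x y → Dec (x ≼ y)) → IsStrictTotalOrder _≡_ _≺_
  isStrictTotalOrder isSLO _≼?_ = isStrictTotalOrderᶜ record
    { isEquivalence = ≡.isEquivalence
    ; trans         = ≺-trans
    ; compare       = compare
    }
    where
    open IsStrictLinearOrder isSLO renaming (trans to ≺-trans)
    compare : Trichotomous _≡_ _≺_
    compare x y with x ≼? y | y ≼? x
    ... | yes (inj₂ refl) | _               = tri≈ (irrefl x) refl (irrefl x)
    ... | yes (inj₁ x≺y)  | _               = tri< x≺y (λ { refl → irrefl x x≺y }) (irrefl x ∘ ≺-trans x≺y)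
    ... | no x⋠y          | yes (inj₁ y≺x)  = tri> (x⋠y ∘ inj₁) (x⋠y ∘ inj₂) y≺x
    ... | no x⋠y          | yes (inj₂ refl) = contradiction (inj₂ refl) x⋠y
    ... | no x⋠y          | no y⋠x          =
      -- Since `≼` is decided in both directions, connectedness in its negative form excludes the
      -- remaining case.
      contradiction (x⋠y ∘ inj₁ , y⋠x ∘ inj₁) (connected x y (x⋠y ∘ inj₂))

module DistanceDecision {A : Set} {_≺_ : A → A → Set} (isSTO : IsStrictTotalOrder _≡_ _≺_) where
  open LinOrder _≺_
  open Extrema _≺_ using (_<±_; ⊥±<[_]; [_]<⊤±; ⊥±<⊤±; <±-isStrictTotalOrder-≡)
    renaming ([_] to [_]<)
  open Distance (<±-isStrictTotalOrder-≡ isSTO)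

  lift≼ : ∀ {x y} → x ≼ y → NonStrict._≤_ _≡_ _<±_ [ x ] [ y ]
  lift≼ (inj₁ p)    = inj₁ [ p ]<
  lift≼ (inj₂ refl) = inj₂ refl

  lower≼ : ∀ {x y} → NonStrict._≤_ _≡_ _<±_ [ x ] [ y ] → x ≼ y
  lower≼ (inj₁ [ p ]<) = inj₁ p
  lower≼ (inj₂ refl)   = inj₂ refl

  chain⇒≲[] : ∀ {x y n} → Chain x y n → [ x ] ≲[ n ] [ y ]
  chain⇒≲[] here       = near (inj₂ refl)
  chain⇒≲[] (step p c) = step [ p ]< (chain⇒≲[] c)

  ≲[]⇒chain : ∀ {x y n} → [ x ] ≲[ n ] [ y ] → ∃ λ z → Chain x z n × z ≼ y
  ≲[]⇒chain (near p)                       = _ , here , lower≼ p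
  ≲[]⇒chain (step {y = [ _ ]} [ p ]< q)    = let z , c , r = ≲[]⇒chain q in z , step p c , r
  ≲[]⇒chain (step {y = ⊤±} _ q)            = ⊥-elim (≲[]-irrefl (step [ _ ]<⊤± q))

  extend : ∀ {x y z n} → Chain x y n → y ≺ z → Chain x z (suc n)
  extend here       q = step q here
  extend (step p c) q = step p (extend c q)

  distGeq⇒≲[] : ∀ {x y n} → DistGeq x y n → [ x ] ≲[ n ] [ y ]
  distGeq⇒≲[] (m , n≤m , c) = ≲[]-antitone n≤m (chain⇒≲[] c)

  ≲[]⇒distGeq : ∀ {x y n} → [ x ] ≲[ n ] [ y ] → DistGeq x y n
  ≲[]⇒distGeq p with ≲[]⇒chain p
  -- A strict final step makes the chain one longer than required, which `DistGeq` permits.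
  ... | z , c , inj₁ z≺y  = _ , n≤1+n _ , extend c z≺y
  ... | z , c , inj₂ refl = _ , ≤-refl , c

  -- The length is `suc n` because the step from `⊥±` to the first point of the chain counts as
  -- well.
  leftChain⇒≲[] : ∀ {x n} → LeftChain x n → ⊥± ≲[ suc n ] [ x ]
  leftChain⇒≲[] (_ , _ , c , b≼x) = step ⊥±<[ _ ] (≲[]-monoʳ (lift≼ b≼x) (chain⇒≲[] c))

  ≲[]⇒leftChain : ∀ {x n} → ⊥± ≲[ suc n ] [ x ] → LeftChain x n
  ≲[]⇒leftChain (step {y = [ _ ]} _ p) = _ , ≲[]⇒chain p
  ≲[]⇒leftChain (step {y = ⊥±} p _)    = ⊥-elim (≲[]-irrefl (step p (near (inj₂ refl))))
  ≲[]⇒leftChain (step {y = ⊤±} _ p)    = ⊥-elim (≲[]-irrefl (step [ _ ]<⊤± p))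

  rightChain⇒≲[] : ∀ {x n} → RightChain x n → [ x ] ≲[ suc n ] ⊤±
  rightChain⇒≲[] {x} {n} (_ , b , x≼b₀ , c) = subst ([ x ] ≲[_] ⊤±) (+-comm n 1)
    (≲[]-trans (≲[]-monoˡ (lift≼ x≼b₀) (chain⇒≲[] c)) (step [ b ]<⊤± (near (inj₂ refl))))

  chainFrom : ∀ {x n} → [ x ] ≲[ suc n ] ⊤± → ∃ λ b → Chain x b n
  chainFrom {n = zero}  _                            = _ , here
  chainFrom {n = suc n} (step {y = [ _ ]} [ p ]< q)  = let b , c = chainFrom q in b , step p c
  chainFrom {n = suc n} (step {y = ⊤±} _ q)          = ⊥-elim (≲[]-irrefl q)

  ≲[]⇒rightChain : ∀ {x n} → [ x ] ≲[ suc n ] ⊤± → RightChain x n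
  ≲[]⇒rightChain p = let b , c = chainFrom p in _ , b , inj₂ refl , c

  -- Types say nothing about the distance of the two extrema; it is measured through the element a.
  module _ (a : A) (distGeq? : ∀ n x y → Dec (DistGeq x y n))
           (left? : ∀ n x → Dec (LeftChain x n)) (right? : ∀ n x → Dec (RightChain x n)) where

    ⊥-dist? : ∀ n x → Dec (⊥± ≲[ n ] [ x ])
    ⊥-dist? zero    x = yes (near (inj₁ ⊥±<[ x ]))
    ⊥-dist? (suc n) x = map′ leftChain⇒≲[] ≲[]⇒leftChain (left? n x)

    ⊤-dist? : ∀ n x → Dec ([ x ] ≲[ n ] ⊤±)
    ⊤-dist? zero    x = yes (near (inj₁ [ x ]<⊤±))
    ⊤-dist? (suc n) x = map′ rightChain⇒≲[] ≲[]⇒rightChain (right? n x)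

    ⊥⊤-dist? : ∀ n → Dec (⊥± ≲[ n ] ⊤±)
    -- Splitting at `a` limits the search to the ways of writing `n` as a sum of two lengths.
    ⊥⊤-dist? n = map′ join split
      (anyUpTo? (λ i → ⊥-dist? i a ×-dec ⊤-dist? (n ∸ i) a) (suc n))
      where
      Split : Set
      Split = ∃ λ i → i < suc n × (⊥± ≲[ i ] [ a ] × [ a ] ≲[ n ∸ i ] ⊤±)
      join : Split → ⊥± ≲[ n ] ⊤±
      join (i , s≤s i≤n , p , q) = subst (⊥± ≲[_] ⊤±) (m+[n∸m]≡n i≤n) (≲[]-trans p q)
      split : ⊥± ≲[ n ] ⊤± → Split
      split r with ≲[]-splitAt (inj₁ ⊥±<[ a ]) (inj₁ [ a ]<⊤±) r
      ... | i , j , refl , p , q =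
        i , s≤s (m≤m+n i j) , p , subst ([ a ] ≲[_] ⊤±) (sym (m+n∸m≡n i j)) q

    reflexive-dist? : ∀ n x → Dec (x ≲[ n ] x)
    reflexive-dist? zero    x = yes (near (inj₂ refl))
    reflexive-dist? (suc n) x = no ≲[]-irrefl

    ≲[]? : ∀ n x y → Dec (x ≲[ n ] y)
    ≲[]? n ⊥±    ⊥±    = reflexive-dist? n ⊥±
    ≲[]? n ⊥±    [ y ] = ⊥-dist? n y
    ≲[]? n ⊥±    ⊤±    = ⊥⊤-dist? n
    ≲[]? n [ x ] ⊥±    = no λ p → ≲[]-irrefl (step ⊥±<[ x ] p)
    ≲[]? n [ x ] [ y ] = map′ distGeq⇒≲[] ≲[]⇒distGeq (distGeq? n x y)
    ≲[]? n [ x ] ⊤±    = ⊤-dist? n x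
    ≲[]? n ⊤±    ⊤±    = reflexive-dist? n ⊤±
    ≲[]? n ⊤±    ⊥±    = no λ p → ≲[]-irrefl (step ⊥±<⊤± p)
    ≲[]? n ⊤±    [ y ] = no λ p → ≲[]-irrefl (step [ y ]<⊤± p)

-- The decision procedure

infty-decidable : {A : Set} (_≺_ : A → A → Set) → LinOrder.IsStrictLinearOrder _≺_ →
                  ((d k : ℕ) (a : Vec A k) → Σ (Tp k) (TpSpec.IsTp _≺_ d a)) →
                  (Π : Program) (P : Fin (Program.nIDB Π)) → 1 ≤ Program.ar Π P →
                  (a : Vec A (Program.ar Π P)) → Dec (Semantics.Infty _≺_ Π P a)
infty-decidable {A} _≺_ isSLO tp Π P 1≤ar a = Saturation.infty? isSTO Π ≲? P a
  where
  open LinOrder _≺_ using (module IsStrictLinearOrder)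
  rel : ∀ d x y → ∃ (TpSpec.RelSpec _≺_ d x y)
  rel d x y = let _ , r , _ = tp d 2 (x ∷ y ∷ []) in _ , r zero (suc zero)
  isSTO : IsStrictTotalOrder _≡_ _≺_
  -- Distance `0` suffices: the presence of the expression in the type already decides `≼`.
  isSTO = isStrictTotalOrder _≺_ isSLO λ x y → relSpec⇒≼? _≺_ (proj₂ (rel 0 x y))
  -- Positive arity provides the element through which the distance of the extrema is measured.
  anchor : ∀ {k} → 1 ≤ k → Vec A k → A
  anchor (s≤s _) (x ∷ _) = x
  ≲? = DistanceDecision.≲[]? isSTO (anchor 1≤ar a)
    (λ n x y → relSpec⇒distGeq? _≺_ (IsStrictLinearOrder.trans isSLO) (proj₂ (rel n x y)))
    (λ n x → let _ , _ , l , _ = tp n 1 (x ∷ []) in maxUpTo? _≺_ (l zero))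
    (λ n x → let _ , _ , _ , r = tp n 1 (x ∷ []) in maxUpTo? _≺_ (r zero))

theorem7p10 : (m : ℕ) (inA : Strings m → Bool)
    (_≺_ : Universe m inA → Universe m inA → Set)
    → LinOrder.IsStrictLinearOrder _≺_
    → (tp : (d k : ℕ) (a : Vec (Universe m inA) k) → Σ (Tp k) (TpSpec.IsTp _≺_ d a))
    → (Π : Program) (P : Fin (Program.nIDB Π)) → IsIDB Π P → 1 ≤ Program.ar Π P
    → (a : Vec (Universe m inA) (Program.ar Π P))
    → Dec (Semantics.Infty _≺_ Π P a)
theorem7p10 m inA _≺_ isSLO tp Π P _ = infty-decidable _≺_ isSLO tp Π P
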